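{- Let $s$ be a Sturmian word having a factorization $s=U_1U_2\cdots U_n\cdots$ where each $U_i$ ($i\ge1$) is a non-empty prefix of $s$. Then there exist integers $i,j\ge1$ with $r_s(U_i)\neq r_s(U_j)$.
   Context: A Sturmian word is an infinite word $s\in\{a,b\}^{\omega}$ that is aperiodic (not ultimately periodic) and balanced: for all factors $u,v$ of $s$ with $|u|=|v|$ one has $||u|_x-|v|_x|\le 1$ for $x\in\{a,b\}$, where $|u|_x$ is the number of occurrences of $x$ in $u$. A non-empty factor $w$ of $s$ is rich in the letter $z\in\{a,b\}$ if there is a factor $v$ of $s$ with $|v|=|w|$ and $|w|_z>|v|_z$; every non-empty factor of a Sturmian word is rich in exactly one letter, and $r_s(w)\in\{a,b\}$ denotes that letter. -}

module Defs where

open import Axiom.ExcludedMiddle using (ExcludedMiddle)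
open import Data.Empty using (⊥-elim)
open import Data.List.Base using (List; []; _∷_; _++_; length; filter; applyUpTo; concat)
open import Data.List.Properties using (length-applyUpTo; applyUpTo-∷ʳ; filter-++; length-++)
open import Data.Nat.Base using (ℕ; zero; suc; _+_; _≤_; _<_; z≤n; s≤s; ∣_-_∣)
open import Data.Nat.Properties
open import Data.Product using (∃-syntax; ∃!; _×_; _,_; proj₁; proj₂)
open import Function.Base using (_∘_)
open import Level using (0ℓ)
open import Relation.Binary.Definitions using (DecidableEquality)
open import Relation.Binary.PropositionalEquality
open import Relation.Nullary using (¬_; yes; no)

data Letter : Set where
  a b : Letter

_≟ᴸ_ : DecidableEquality Letter
a ≟ᴸ a = yes refl
a ≟ᴸ b = no λ ()
b ≟ᴸ a = no λ ()
b ≟ᴸ b = yes refl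

Word : Set
Word = List Letter

ωWord : Set
ωWord = ℕ → Letter

∣_∣[_] : Word → Letter → ℕ
∣ w ∣[ x ] = length (filter (x ≟ᴸ_) w)

-- The word s(i) s(i+1) ⋯ s(i+n-1).
window : ωWord → ℕ → ℕ → Word
window s i n = applyUpTo (λ k → s (i + k)) n

IsFactor : Word → ωWord → Set
IsFactor w s = ∃[ i ] w ≡ window s i (length w)

IsPrefix : Word → ωWord → Set
IsPrefix w s = w ≡ window s 0 (length w)

prefix⇒factor : ∀ w s → IsPrefix w s → IsFactor w s
prefix⇒factor w s p = 0 , p

UltimatelyPeriodic : ωWord → Set
UltimatelyPeriodic s =
  ∃[ N ] ∃[ p ] 1 ≤ p × (∀ n → N ≤ n → s (n + p) ≡ s n)

-- "Not ultimately periodic" with the negation pushed through the quantifiers.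
-- A bare ¬ UltimatelyPeriodic s would not constructively produce the position
-- where a period fails, hence neither the word v in the definition of richness.
-- The two lemmas below show that classically this is the negation.
Aperiodic : ωWord → Set
Aperiodic s =
  ∀ N p → 1 ≤ p → ∃[ n ] N ≤ n × s (n + p) ≢ s n

aperiodic⇒¬ultimatelyPeriodic : ∀ {s} → Aperiodic s → ¬ UltimatelyPeriodic s
aperiodic⇒¬ultimatelyPeriodic ap (N , p , 1≤p , per) with ap N p 1≤p
... | n , N≤n , s≢s = s≢s (per n N≤n)

¬ultimatelyPeriodic⇒aperiodic :
  ExcludedMiddle 0ℓ → ∀ {s} → ¬ UltimatelyPeriodic s → Aperiodic s
¬ultimatelyPeriodic⇒aperiodic em {s} ¬up N p 1≤p
  with em {∃[ n ] N ≤ n × s (n + p) ≢ s n}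
... | yes e = e
... | no ¬e = ⊥-elim (¬up (N , p , 1≤p , per))
  where
  per : ∀ n → N ≤ n → s (n + p) ≡ s n
  per n N≤n with s (n + p) ≟ᴸ s n
  ... | yes eq = eq
  ... | no neq = ⊥-elim (¬e (n , N≤n , neq))

Balanced : ωWord → Set
Balanced s =
  ∀ u v → IsFactor u s → IsFactor v s → length u ≡ length v →
  ∀ x → ∣ ∣ u ∣[ x ] - ∣ v ∣[ x ] ∣ ≤ 1

record Sturmian (s : ωWord) : Set where
  field
    aperiodic : Aperiodic s
    balanced  : Balanced s

RichIn : ωWord → Word → Letter → Set
RichIn s w z =
  ∃[ v ] IsFactor v s × length v ≡ length w × ∣ v ∣[ z ] < ∣ w ∣[ z ]

count-ab : ∀ w → ∣ w ∣[ a ] + ∣ w ∣[ b ] ≡ length w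
count-ab []      = refl
count-ab (a ∷ w) = cong suc (count-ab w)
count-ab (b ∷ w) = trans (+-suc ∣ w ∣[ a ] _) (cong suc (count-ab w))

fewer-a⇒more-b : ∀ u v → length u ≡ length v →
                 ∣ u ∣[ a ] < ∣ v ∣[ a ] → ∣ v ∣[ b ] < ∣ u ∣[ b ]
fewer-a⇒more-b u v eq lt = ≰⇒> λ le → <-irrefl
  (trans (count-ab u) (trans eq (sym (count-ab v))))
  (+-mono-<-≤ lt le)

fewer-b⇒more-a : ∀ u v → length u ≡ length v →
                 ∣ u ∣[ b ] < ∣ v ∣[ b ] → ∣ v ∣[ a ] < ∣ u ∣[ a ]
fewer-b⇒more-a u v eq lt = ≰⇒> λ le → <-irrefl
  (trans (count-ab u) (trans eq (sym (count-ab v))))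
  (+-mono-≤-< le lt)

length-window : ∀ s i n → length (window s i n) ≡ n
length-window s i n = length-applyUpTo _ n

window-factor : ∀ s i n → IsFactor (window s i n) s
window-factor s i n = i , cong (window s i) (sym (length-window s i n))

applyUpTo-cong : ∀ {f g : ωWord} → (∀ k → f k ≡ g k) → ∀ n →
                 applyUpTo f n ≡ applyUpTo g n
applyUpTo-cong eq zero    = refl
applyUpTo-cong eq (suc n) = cong₂ _∷_ (eq 0) (applyUpTo-cong (eq ∘ suc) n)

count-++ : ∀ x u v → ∣ u ++ v ∣[ x ] ≡ ∣ u ∣[ x ] + ∣ v ∣[ x ]
count-++ x u v = trans (cong length (filter-++ (x ≟ᴸ_) u v))
                       (length-++ (filter (x ≟ᴸ_) u))

count-shift : ∀ s i n x →
  ∣ window s i n ∣[ x ] + ∣ s (i + n) ∷ [] ∣[ x ] ≡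
  ∣ s i ∷ [] ∣[ x ] + ∣ window s (suc i) n ∣[ x ]
count-shift s i n x = begin
  ∣ window s i n ∣[ x ] + ∣ s (i + n) ∷ [] ∣[ x ]
    ≡⟨ count-++ x (window s i n) _ ⟨
  ∣ window s i n ++ (s (i + n) ∷ []) ∣[ x ]
    ≡⟨ cong ∣_∣[ x ] (applyUpTo-∷ʳ (λ k → s (i + k)) n) ⟩
  ∣ s (i + 0) ∷ applyUpTo (λ k → s (i + suc k)) n ∣[ x ]
    ≡⟨ cong ∣_∣[ x ] (cong₂ _∷_ (cong s (+-identityʳ i))
         (applyUpTo-cong (λ k → cong s (+-suc i k)) n)) ⟩
  ∣ s i ∷ window s (suc i) n ∣[ x ]
    ≡⟨ count-++ x (s i ∷ []) _ ⟩
  ∣ s i ∷ [] ∣[ x ] + ∣ window s (suc i) n ∣[ x ] ∎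
  where open ≡-Reasoning

unequal-windows : ∀ {s} → Aperiodic s → ∀ n → 1 ≤ n →
  ∃[ i ] ∃[ j ] ∣ window s i n ∣[ a ] < ∣ window s j n ∣[ a ]
unequal-windows {s} ap n 1≤n with ap 0 n 1≤n
... | i , _ , s≢s with s (i + n) | s i | count-shift s i n a
... | a | a | _  = ⊥-elim (s≢s refl)
... | b | b | _  = ⊥-elim (s≢s refl)
... | a | b | eq = i , suc i , ≤-reflexive (trans (+-comm 1 _) eq)
... | b | a | eq = suc i , i , ≤-reflexive (sym (trans (sym (+-identityʳ _)) eq))

non-empty : ∀ {w : Word} → w ≢ [] → 1 ≤ length w
non-empty {[]}    w≢[] = ⊥-elim (w≢[] refl)
non-empty {_ ∷ _} _    = s≤s z≤n

¬rich-in-both : ∀ s → Balanced s → ∀ w → RichIn s w a → ¬ RichIn s w b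
¬rich-in-both s bal w (u , uf , ul , u<w) (v , vf , vl , v<w) =
  <⇒≱ gap (bal v u vf uf (trans vl (sym ul)) a)
  where
  open ≤-Reasoning
  w<v = fewer-b⇒more-a v w vl v<w
  gap : 1 < ∣ ∣ v ∣[ a ] - ∣ u ∣[ a ] ∣
  gap = +-cancelˡ-≤ ∣ u ∣[ a ] 2 _ (begin
    ∣ u ∣[ a ] + 2                                ≡⟨ +-comm _ 2 ⟩
    2 + ∣ u ∣[ a ]                                ≤⟨ s≤s u<w ⟩
    1 + ∣ w ∣[ a ]                                ≤⟨ w<v ⟩
    ∣ v ∣[ a ]                                    ≤⟨ m≤n+∣m-n∣ ∣ v ∣[ a ] ∣ u ∣[ a ] ⟩
    ∣ u ∣[ a ] + ∣ ∣ v ∣[ a ] - ∣ u ∣[ a ] ∣      ∎)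

existsUniqueRich : ∀ {s} → Sturmian s → ∀ w → w ≢ [] → IsFactor w s →
                   ∃! _≡_ (RichIn s w)
existsUniqueRich {s} st w w≢[] _
  with unequal-windows (Sturmian.aperiodic st) (length w) (non-empty w≢[])
... | i , j , vi<vj with ∣ window s i (length w) ∣[ a ] <? ∣ w ∣[ a ]
... | yes vi<w = a , rich , λ { {a} _ → refl
                              ; {b} r → ⊥-elim (¬rich-in-both s balanced w rich r) }
  where
  open Sturmian st
  rich : RichIn s w a
  rich = window s i (length w) , window-factor s i _ , length-window s i _ , vi<w
... | no vi≮w = b , rich , λ { {a} r → ⊥-elim (¬rich-in-both s balanced w r rich)
                             ; {b} _ → refl }
  where
  open Sturmian st
  vj = window s j (length w)
  rich : RichIn s w b
  rich = vj , window-factor s j _ , length-window s j _ ,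
         fewer-a⇒more-b w vj (sym (length-window s j _))
           (≤-<-trans (≮⇒≥ vi≮w) vi<vj)

r : ∀ {s} → Sturmian s → ∀ w → w ≢ [] → IsFactor w s → Letter
r st w w≢[] wf = proj₁ (existsUniqueRich st w w≢[] wf)

-- s = U 0 · U 1 · U 2 ⋯ (indices shifted to start at 0); for non-empty blocks
-- the finite partial products being prefixes of s determines the product.
record PrefixFactorization (s : ωWord) (U : ℕ → Word) : Set where
  field
    nonEmpty : ∀ i → U i ≢ []
    prefix   : ∀ i → IsPrefix (U i) s
    product  : ∀ n → IsPrefix (concat (applyUpTo U n)) s

{-# OPTIONS --safe #-}
-- Suppose every U k is rich in the same letter x, and write c i n for the number
-- of x in the factor of length n at position i.  By balance every prefix U k has
-- the largest possible count for its length.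
--
-- The lengths ∣U k∣ are bounded: let j be a position with c j ∣U 0∣ < c 0 ∣U 0∣.
-- For N = ∣U 0 ⋯ U k∣ maximality gives c j N < c 0 N.  If U (k + 1), a prefix of s
-- occurring at N, had length at least j, then c N j = c 0 j, and splitting the
-- prefix of length N + j = j + N in two ways gives c 0 N + c 0 j = c 0 j + c j N.
--
-- The counts exceed the mean by a fixed amount: by aperiodicity, infinitely many
-- factors of each length n have fewer x than a maximal one.  Since
-- Σ_{i<Q} c i n = Σ_{i<n} c i Q, for large Q all the finitely many lengths n = ∣U k∣
-- satisfy n (c 0 Q + 1) + 1 ≤ Q · c 0 n.  Summing over k < K with N = ∣U 0 ⋯ U (K-1)∣,
-- N (c 0 Q + 1) + K ≤ Q · c 0 N, while balance gives Q · c 0 N ≤ Q + N (c 0 Q + 1).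
-- Hence K ≤ Q.
module Submission where

open import Defs
open import Data.Empty using (⊥-elim)
open import Data.List.Base using (List; []; _∷_; _++_; length; applyUpTo; concat)
open import Data.List.Properties
  using (length-++; applyUpTo-∷ʳ; concat-++; ++-identityʳ; ∷-injective)
open import Data.Nat using (ℕ; zero; suc; _+_; _*_; _≤_; _<_; z≤n; s≤s; ∣_-_∣)
open import Data.Nat.Properties
open import Data.Nat.Tactic.RingSolver using (solve-∀)
open import Data.Product using (∃-syntax; _×_; _,_; proj₁; proj₂; map₂)
open import Data.Sum using (inj₁; inj₂)
open import Function.Base using (_∘_)
open import Relation.Binary.Definitions using (tri<; tri≈; tri>)
open import Relation.Binary.PropositionalEquality
  using (_≡_; _≢_; refl; sym; trans; cong; cong₂; subst; subst₂; module ≡-Reasoning)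
open import Relation.Nullary using (¬_; yes; no; ¬?)
open import Relation.Nullary.Decidable using (decidable-stable)

-- Finite sums of natural numbers.

Σ< : ℕ → (ℕ → ℕ) → ℕ
Σ< zero    f = 0
Σ< (suc n) f = Σ< n f + f n

Σ<-+ : ∀ f g n → Σ< n (λ i → f i + g i) ≡ Σ< n f + Σ< n g
Σ<-+ f g zero    = refl
Σ<-+ f g (suc n) = trans (cong (_+ (f n + g n)) (Σ<-+ f g n))
                         (interchange (Σ< n f) (Σ< n g) (f n) (g n))
  where
  interchange : ∀ p q u v → (p + q) + (u + v) ≡ (p + u) + (q + v)
  interchange = solve-∀

Σ<-cong : ∀ {f g} → (∀ i → f i ≡ g i) → ∀ n → Σ< n f ≡ Σ< n g
Σ<-cong eq zero    = refl
Σ<-cong eq (suc n) = cong₂ _+_ (Σ<-cong eq n) (eq n)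

Σ<-mono : ∀ {f g} → (∀ i → f i ≤ g i) → ∀ n → Σ< n f ≤ Σ< n g
Σ<-mono le zero    = z≤n
Σ<-mono le (suc n) = +-mono-≤ (Σ<-mono le n) (le n)

Σ<-const : ∀ h n → Σ< n (λ _ → h) ≡ n * h
Σ<-const h zero    = refl
Σ<-const h (suc n) = trans (+-comm _ h) (cong (h +_) (Σ<-const h n))

Σ<-zero : ∀ n → Σ< n (λ _ → 0) ≡ 0
Σ<-zero n = trans (Σ<-const 0 n) (*-zeroʳ n)

Σ<-≤ : ∀ {f h} → (∀ i → f i ≤ h) → ∀ n → Σ< n f ≤ n * h
Σ<-≤ {h = h} le n = ≤-trans (Σ<-mono le n) (≤-reflexive (Σ<-const h n))

Σ<-≥ : ∀ {f h d} → (∀ i → h ≤ d + f i) → ∀ n → n * h ≤ n * d + Σ< n f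
Σ<-≥ {f} {h} {d} le n = begin
  n * h                      ≡⟨ Σ<-const h n ⟨
  Σ< n (λ _ → h)             ≤⟨ Σ<-mono le n ⟩
  Σ< n (λ i → d + f i)       ≡⟨ Σ<-+ (λ _ → d) f n ⟩
  Σ< n (λ _ → d) + Σ< n f    ≡⟨ cong (_+ Σ< n f) (Σ<-const d n) ⟩
  n * d + Σ< n f             ∎
  where open ≤-Reasoning

-- Properties holding from some index on.

Eventually : (ℕ → Set) → Set
Eventually P = ∃[ q₀ ] (∀ q → q₀ ≤ q → P q)

eventually-step : ∀ {P : ℕ → Set} q₀ → P q₀ → (∀ q → P q → P (suc q)) →
                  Eventually P
eventually-step {P} q₀ base step = q₀ , go
  where
  go : ∀ q → q₀ ≤ q → P q
  go q q₀≤q with m≤n⇒m<n∨m≡n q₀≤q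
  ... | inj₂ refl            = base
  go (suc q) _ | inj₁ q₀<1+q = step q (go q (≤-pred q₀<1+q))

eventually-all< : ∀ {P : ℕ → ℕ → Set} → (∀ n → Eventually (P n)) →
                  ∀ m → Eventually (λ q → ∀ n → n < m → P n q)
eventually-all< ev zero = 0 , λ _ _ _ ()
eventually-all< {P} ev (suc m) with ev m | eventually-all< ev m
... | q₁ , h₁ | q₂ , h₂ = q₁ + q₂ , all
  where
  all : ∀ q → q₁ + q₂ ≤ q → ∀ n → n < suc m → P n q
  all q le n n<1+m with m<1+n⇒m<n∨m≡n n<1+m
  ... | inj₁ n<m  = h₂ q (≤-trans (m≤n+m q₂ q₁) le) n n<m
  ... | inj₂ refl = h₁ q (≤-trans (m≤m+n q₁ q₂) le)

-- Splitting and comparing windows.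

window-+ : ∀ s i m n → window s i (m + n) ≡ window s i m ++ window s (i + m) n
window-+ s i zero n = cong (λ k → window s k n) (sym (+-identityʳ i))
window-+ s i (suc m) n = cong (s (i + 0) ∷_)
  (trans (shift (m + n))
  (trans (window-+ s (suc i) m n)
         (cong₂ _++_ (sym (shift m)) (cong (λ k → window s k n) (sym (+-suc i m))))))
  where
  shift : ∀ l → applyUpTo (λ k → s (i + suc k)) l ≡ window s (suc i) l
  shift = applyUpTo-cong (λ k → cong s (+-suc i k))

++-injective : ∀ {A : Set} (u v : List A) {u′ v′} → length u ≡ length v →
               u ++ u′ ≡ v ++ v′ → u ≡ v × u′ ≡ v′
++-injective []      []      _   eq = refl , eq
++-injective (x ∷ u) (y ∷ v) leq eq with ∷-injective eq
... | x≡y , eq′ with ++-injective u v (suc-injective leq) eq′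
... | u≡v , u′≡v′ = cong₂ _∷_ x≡y u≡v , u′≡v′

factor-of-prefix : ∀ {s} u v → IsPrefix (u ++ v) s → v ≡ window s (length u) (length v)
factor-of-prefix {s} u v p = proj₂ (++-injective u (window s 0 (length u))
  (sym (length-window s 0 (length u)))
  (trans p (trans (cong (window s 0) (length-++ u)) (window-+ s 0 (length u) (length v)))))

window-prefix : ∀ s i j {m n} → m ≤ n → window s i n ≡ window s j n →
                window s i m ≡ window s j m
window-prefix s i j {m} m≤n eq with m≤n⇒∃[o]m+o≡n m≤n
... | o , refl = proj₁ (++-injective (window s i m) (window s j m)
  (trans (length-window s i m) (sym (length-window s j m)))
  (trans (sym (window-+ s i m o)) (trans eq (window-+ s j m o))))

count-letter-injective : ∀ x y z → ∣ y ∷ [] ∣[ x ] ≡ ∣ z ∷ [] ∣[ x ] → y ≡ z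
count-letter-injective x a a _ = refl
count-letter-injective x b b _ = refl
count-letter-injective a a b ()
count-letter-injective a b a ()
count-letter-injective b a b ()
count-letter-injective b b a ()

-- Letter counts of windows and their mean.

module WindowCounts (s : ωWord) (st : Sturmian s) (x : Letter) where
  open Sturmian st

  c : ℕ → ℕ → ℕ
  c i n = ∣ window s i n ∣[ x ]

  c-+ : ∀ i m n → c i (m + n) ≡ c i m + c (i + m) n
  c-+ i m n = trans (cong ∣_∣[ x ] (window-+ s i m n))
                    (count-++ x (window s i m) (window s (i + m) n))

  c-suc : ∀ i n → c i (suc n) ≡ c i n + c (i + n) 1
  c-suc i n = trans (cong (c i) (+-comm 1 n)) (c-+ i n 1)

  c-balanced : ∀ i j n → c i n ≤ 1 + c j n
  c-balanced i j n = begin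
    c i n                        ≤⟨ m≤n+∣m-n∣ (c i n) (c j n) ⟩
    c j n + ∣ c i n - c j n ∣    ≤⟨ +-monoʳ-≤ (c j n) near ⟩
    c j n + 1                    ≡⟨ +-comm _ 1 ⟩
    1 + c j n                    ∎
    where
    open ≤-Reasoning
    near = balanced _ _ (window-factor s i n) (window-factor s j n)
             (trans (length-window s i n) (sym (length-window s j n))) x

  -- Sliding the window one place drops `s q` and adds `s (q + n)`. Since `n` is not an eventual
  -- period, these letters differ at some `q` beyond `N`.
  c-varies : ∀ N n → 1 ≤ n → ∃[ q ] N ≤ q × c q n ≢ c (suc q) n
  c-varies N n 1≤n with aperiodic N n 1≤n
  ... | q , N≤q , s≢s = q , N≤q , λ eq → s≢s (count-letter-injective x _ _
    (+-cancelˡ-≡ (c q n) _ _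
      (trans (count-shift s q n x) (trans (cong (∣ s q ∷ [] ∣[ x ] +_) (sym eq)) (+-comm _ (c q n))))))

  Σ-c-1 : ∀ q n → Σ< n (λ i → c (i + q) 1) ≡ c q n
  Σ-c-1 q zero    = refl
  Σ-c-1 q (suc n) = trans (cong₂ _+_ (Σ-c-1 q n) (cong (λ k → c k 1) (+-comm n q)))
                          (sym (c-suc q n))

  -- Double counting: both sides count the pairs `i < n`, `k < q` with `s (i + k)` equal to `x`.
  Σ-c-swap : ∀ n q → Σ< n (λ i → c i q) ≡ Σ< q (λ i → c i n)
  Σ-c-swap n zero    = Σ<-zero n
  Σ-c-swap n (suc q) = trans (Σ<-cong (λ i → c-suc i q) n)
    (trans (Σ<-+ (λ i → c i q) (λ i → c (i + q) 1) n)
           (cong₂ _+_ (Σ-c-swap n q) (Σ-c-1 q n)))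

  Maximal : ℕ → Set
  Maximal n = ∀ i → c i n ≤ c 0 n

  -- By balance no count exceeds another by more than 1, so a prefix that beats one window is beaten
  -- by none.
  below⇒maximal : ∀ j n → c j n < c 0 n → Maximal n
  below⇒maximal j n lt i = ≤-trans (c-balanced i j n) lt

  -- The first `q` windows of length `n` fall short of the maximum by at least `d` in total.
  -- Maximality is a premise so that a threshold for `q` can be chosen for every length, before it
  -- is known which lengths are maximal.
  Deficit : ℕ → ℕ → ℕ → Set
  Deficit d n q = Maximal n → Σ< q (λ i → c i n) + d ≤ q * c 0 n

  deficit-step : ∀ d n q → Deficit d n q → Deficit d n (suc q)
  deficit-step d n q def max = begin
    Σ< q (λ i → c i n) + c q n + d    ≡⟨ move (Σ< q (λ i → c i n)) (c q n) d ⟩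
    c q n + (Σ< q (λ i → c i n) + d)  ≤⟨ +-mono-≤ (max q) (def max) ⟩
    c 0 n + q * c 0 n                 ∎
    where
    open ≤-Reasoning
    move : ∀ u v w → u + v + w ≡ v + (u + w)
    move = solve-∀

  -- Two consecutive distinct counts cannot both be maximal.
  deficit-gain : ∀ d n q → c q n ≢ c (suc q) n → Deficit d n q →
                 Deficit (suc d) n (2 + q)
  deficit-gain d n q neq def max = begin
    Σ< q (λ i → c i n) + c q n + c (suc q) n + suc d
      ≡⟨ move (Σ< q (λ i → c i n)) (c q n) (c (suc q) n) d ⟩
    suc (c q n + c (suc q) n) + (Σ< q (λ i → c i n) + d)
      ≤⟨ +-mono-≤ pair (def max) ⟩
    (c 0 n + c 0 n) + q * c 0 n
      ≡⟨ +-assoc (c 0 n) (c 0 n) _ ⟩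
    c 0 n + (c 0 n + q * c 0 n) ∎
    where
    open ≤-Reasoning
    move : ∀ u v w d → u + v + w + suc d ≡ suc (v + w) + (u + d)
    move = solve-∀
    pair : c q n + c (suc q) n < c 0 n + c 0 n
    pair with <-cmp (c q n) (c (suc q) n)
    ... | tri< lt _ _ = +-mono-<-≤ (<-≤-trans lt (max (suc q))) (max (suc q))
    ... | tri≈ _ eq _ = ⊥-elim (neq eq)
    ... | tri> _ _ gt = +-mono-≤-< (max q) (<-≤-trans gt (max q))

  -- Each further unit of deficit comes from a change of count beyond the previous threshold; later
  -- windows never reduce the deficit.
  deficit-unbounded : ∀ d n → 1 ≤ n → Eventually (Deficit d n)
  deficit-unbounded zero n 1≤n = 0 , λ q _ max →
    ≤-trans (≤-reflexive (+-identityʳ _)) (Σ<-≤ max q)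
  deficit-unbounded (suc d) n 1≤n with deficit-unbounded d n 1≤n
  ... | q₀ , def with c-varies q₀ n 1≤n
  ... | q , q₀≤q , neq =
    eventually-step (2 + q) (deficit-gain d n q neq (def q q₀≤q)) (deficit-step (suc d) n)

  -- With α the frequency of x, c 0 n ≥ α n + 1/q, where α is approximated from
  -- above by (1 + c 0 q) / q.
  ExceedsMean : ℕ → ℕ → Set
  ExceedsMean n q = 1 ≤ n → Maximal n → n * suc (c 0 q) + 1 ≤ q * c 0 n

  -- Balance gives `suc (c 0 q) ≤ 2 + c i q`. Summing over `i < n` costs `n + n`, and the last unit
  -- of the deficit is the surplus.
  deficit⇒exceedsMean : ∀ n q → Deficit (n + n + 1) n q → ExceedsMean n q
  deficit⇒exceedsMean n q def _ max = begin
    n * suc (c 0 q) + 1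
      ≤⟨ +-monoˡ-≤ 1 (Σ<-≥ (λ i → s≤s (c-balanced 0 i q)) n) ⟩
    n * 2 + Σ< n (λ i → c i q) + 1
      ≡⟨ cong (λ z → n * 2 + z + 1) (Σ-c-swap n q) ⟩
    n * 2 + Σ< q (λ i → c i n) + 1
      ≡⟨ move n (Σ< q (λ i → c i n)) ⟩
    Σ< q (λ i → c i n) + (n + n + 1)
      ≤⟨ def max ⟩
    q * c 0 n ∎
    where
    open ≤-Reasoning
    move : ∀ n t → n * 2 + t + 1 ≡ t + (n + n + 1)
    move = solve-∀

  eventually-exceedsMean : ∀ n → Eventually (ExceedsMean n)
  eventually-exceedsMean zero = 0 , λ _ _ ()
  eventually-exceedsMean n@(suc _) =
    map₂ (λ def q q₀≤q → deficit⇒exceedsMean n q (def q q₀≤q))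
         (deficit-unbounded (n + n + 1) n (s≤s z≤n))

  -- Balance is applied on both sides of the double count: to windows of length `n`, then to windows
  -- of length `q`.
  c-≤-mean : ∀ n q → q * c 0 n ≤ q + n * suc (c 0 q)
  c-≤-mean n q = begin
    q * c 0 n                       ≤⟨ Σ<-≥ (λ i → c-balanced 0 i n) q ⟩
    q * 1 + Σ< q (λ i → c i n)      ≡⟨ cong₂ _+_ (*-identityʳ q) (sym (Σ-c-swap n q)) ⟩
    q + Σ< n (λ i → c i q)          ≤⟨ +-monoʳ-≤ q (Σ<-≤ (λ i → c-balanced i 0 q) n) ⟩
    q + n * suc (c 0 q)             ∎
    where open ≤-Reasoning

-- Blocks of the factorization.

module Blocks {s : ωWord} (st : Sturmian s) {U : ℕ → Word}
              (F : PrefixFactorization s U) (x : Letter) where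
  open PrefixFactorization F
  open WindowCounts s st x

  ℓ : ℕ → ℕ
  ℓ k = length (U k)

  pos : ℕ → ℕ
  pos k = Σ< k ℓ

  concat-suc : ∀ k → concat (applyUpTo U (suc k)) ≡ concat (applyUpTo U k) ++ U k
  concat-suc k = trans (cong concat (sym (applyUpTo-∷ʳ U k)))
    (trans (sym (concat-++ (applyUpTo U k) (U k ∷ [])))
           (cong (concat (applyUpTo U k) ++_) (++-identityʳ (U k))))

  length-concat : ∀ k → length (concat (applyUpTo U k)) ≡ pos k
  length-concat zero    = refl
  length-concat (suc k) = trans (cong length (concat-suc k))
    (trans (length-++ (concat (applyUpTo U k))) (cong (_+ ℓ k) (length-concat k)))

  block : ∀ k → U k ≡ window s (pos k) (ℓ k)
  block k = trans
    (factor-of-prefix (concat (applyUpTo U k)) (U k)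
      (subst (λ w → IsPrefix w s) (concat-suc k) (product (suc k))))
    (cong (λ i → window s i (ℓ k)) (length-concat k))

  -- `U k` occurs both at `pos k` and at 0, so the windows there agree up to length `ℓ k`.
  c-pos : ∀ k {m} → m ≤ ℓ k → c (pos k) m ≡ c 0 m
  c-pos k m≤ℓ = cong ∣_∣[ x ]
    (window-prefix s (pos k) 0 m≤ℓ (trans (sym (block k)) (prefix k)))

  rich⇒below : ∀ k → RichIn s (U k) x → ∃[ j ] c j (ℓ k) < c 0 (ℓ k)
  rich⇒below k (v , (j , v≡) , lv , lt) = j , subst₂ (λ u w → ∣ u ∣[ x ] < ∣ w ∣[ x ])
    (trans v≡ (cong (window s j) lv)) (prefix k) lt

  rich⇒maximal : ∀ k → RichIn s (U k) x → Maximal (ℓ k)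
  rich⇒maximal k rich with rich⇒below k rich
  ... | j , lt = below⇒maximal j (ℓ k) lt

  block-maximal : ∀ k → Maximal (ℓ k) → ∀ i → c i (ℓ k) ≤ c (pos k) (ℓ k)
  block-maximal k max i = ≤-trans (max i) (≤-reflexive (sym (c-pos k ≤-refl)))

  -- The window at `j` is cut at the same lengths as the prefix. It loses on the first piece and
  -- never wins on a later one, where the block attains the maximum.
  below-extends : ∀ j k → c j (ℓ 0) < c 0 (ℓ 0) → (∀ i → i ≤ k → Maximal (ℓ i)) →
                  c j (pos (suc k)) < c 0 (pos (suc k))
  below-extends j zero    lt max = lt
  below-extends j (suc k) lt max = subst₂ _<_
    (sym (c-+ j (pos (suc k)) (ℓ (suc k)))) (sym (c-+ 0 (pos (suc k)) (ℓ (suc k))))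
    (+-mono-<-≤ (below-extends j k lt (λ i i≤k → max i (m≤n⇒m≤1+n i≤k)))
                (block-maximal (suc k) (max (suc k) ≤-refl) _))

  -- The bound `j` is independent of `k`, so only finitely many block lengths need a common `q`.
  short : ∀ j k → c j (ℓ 0) < c 0 (ℓ 0) → (∀ i → i ≤ k → Maximal (ℓ i)) →
          ℓ (suc k) < j
  short j k lt max = ≰⇒> λ j≤ℓ → <⇒≢ (below-extends j k lt max)
    (sym (+-cancelˡ-≡ (c 0 j) _ _ (begin
      c 0 j + c 0 N    ≡⟨ +-comm (c 0 j) _ ⟩
      c 0 N + c 0 j    ≡⟨ cong (c 0 N +_) (c-pos (suc k) j≤ℓ) ⟨
      c 0 N + c N j    ≡⟨ c-+ 0 N j ⟨
      c 0 (N + j)      ≡⟨ cong (c 0) (+-comm N j) ⟩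
      c 0 (j + N)      ≡⟨ c-+ 0 j N ⟩
      c 0 j + c j N    ∎)))
    where
    open ≡-Reasoning
    N = pos (suc k)

  -- Every block contributes a surplus of 1, and the surpluses add up because a block has the same
  -- count at its position as at 0.
  exceedsMean-pos : ∀ q K → (∀ k → k < K → Maximal (ℓ k)) →
                      (∀ k → k < K → ExceedsMean (ℓ k) q) →
                      pos K * suc (c 0 q) + K ≤ q * c 0 (pos K)
  exceedsMean-pos q zero max exc = z≤n
  exceedsMean-pos q (suc K) max exc = begin
    (N + ℓ K) * h + suc K              ≡⟨ split N (ℓ K) h K ⟩
    (N * h + K) + (ℓ K * h + 1)        ≤⟨ +-mono-≤ rec new ⟩
    q * c 0 N + q * c 0 (ℓ K)          ≡⟨ *-distribˡ-+ q (c 0 N) _ ⟨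
    q * (c 0 N + c 0 (ℓ K))            ≡⟨ cong (λ z → q * (c 0 N + z)) (c-pos K ≤-refl) ⟨
    q * (c 0 N + c N (ℓ K))            ≡⟨ cong (q *_) (c-+ 0 N (ℓ K)) ⟨
    q * c 0 (N + ℓ K)                  ∎
    where
    open ≤-Reasoning
    N = pos K
    h = suc (c 0 q)
    split : ∀ n l h k → (n + l) * h + suc k ≡ (n * h + k) + (l * h + 1)
    split = solve-∀
    rec = exceedsMean-pos q K (λ k → max k ∘ m<n⇒m<1+n) (λ k → exc k ∘ m<n⇒m<1+n)
    new = exc K ≤-refl (non-empty (nonEmpty K)) (max K ≤-refl)

  rich-run-bounded : RichIn s (U 0) x →
                     ∃[ K ] ¬ (∀ k → k < K → RichIn s (U k) x)
  -- `suc q` blocks yield a surplus of `suc q`, whereas `c-≤-mean` allows at most `q`.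
  rich-run-bounded rich₀ = suc q , contradictory
    where
    j  = proj₁ (rich⇒below 0 rich₀)
    lt = proj₂ (rich⇒below 0 rich₀)
    -- The bound covers the first block, of length `ℓ 0`, and the later ones, shorter than `j`.
    uniform : Eventually (λ q → ∀ n → n < j + suc (ℓ 0) → ExceedsMean n q)
    uniform = eventually-all< eventually-exceedsMean (j + suc (ℓ 0))
    q = proj₁ uniform

    contradictory : ¬ (∀ k → k < suc q → RichIn s (U k) x)
    contradictory rich = 1+n≰n (+-cancelˡ-≤ (N * suc (c 0 q)) (suc q) q (begin
      N * suc (c 0 q) + suc q
        ≤⟨ exceedsMean-pos q (suc q) maximal
             (λ k k< → proj₂ uniform q ≤-refl (ℓ k) (bounded k k<)) ⟩
      q * c 0 N
        ≤⟨ c-≤-mean N q ⟩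
      q + N * suc (c 0 q)
        ≡⟨ +-comm q _ ⟩
      N * suc (c 0 q) + q ∎))
      where
      open ≤-Reasoning
      N = pos (suc q)
      maximal : ∀ k → k < suc q → Maximal (ℓ k)
      maximal k = rich⇒maximal k ∘ rich k
      bounded : ∀ k → k < suc q → ℓ k < j + suc (ℓ 0)
      bounded zero    _  = m≤n+m _ j
      bounded (suc k) k< = ≤-trans
        (short j k lt (λ i i≤k → maximal i (≤-trans (s≤s i≤k) (<⇒≤ k<))))
        (m≤m+n j _)

-- Finding two blocks rich in different letters.

r-rich : ∀ {s} (st : Sturmian s) w w≢[] wf → RichIn s w (r st w w≢[] wf)
r-rich st w w≢[] wf = proj₁ (proj₂ (existsUniqueRich st w w≢[] wf))

mainTheorem7 : (s : ωWord) (st : Sturmian s) (U : ℕ → Word) (F : PrefixFactorization s U) →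
    let open PrefixFactorization F in
    ∃[ i ] ∃[ j ]
    r st (U i) (nonEmpty i) (prefix⇒factor (U i) s (prefix i)) ≢
    r st (U j) (nonEmpty j) (prefix⇒factor (U j) s (prefix j))
mainTheorem7 s st U F =
  conclude (Blocks.rich-run-bounded st F (letter 0) (rich 0))
  where
  open PrefixFactorization F

  letter : ℕ → Letter
  letter k = r st (U k) (nonEmpty k) (prefix⇒factor (U k) s (prefix k))

  rich : ∀ k → RichIn s (U k) (letter k)
  rich k = r-rich st (U k) (nonEmpty k) (prefix⇒factor (U k) s (prefix k))

  conclude : ∃[ K ] ¬ (∀ k → k < K → RichIn s (U k) (letter 0)) →
             ∃[ i ] ∃[ j ] letter i ≢ letter j
  -- Equality of letters is decidable and `K` is explicit, so a bounded search turns the refutation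
  -- into a witness.
  conclude (K , ¬allRich) with anyUpTo? (λ k → ¬? (letter k ≟ᴸ letter 0)) K
  ... | yes (k , _ , neq) = k , 0 , neq
  ... | no none = ⊥-elim (¬allRich λ k k<K → subst (RichIn s (U k))
          (decidable-stable (letter k ≟ᴸ letter 0) (λ neq → none (k , k<K , neq))) (rich k))
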